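{- Let $k\geq 2$ and $n\geq k$ be integers. In the quasi-shuffle algebra $(\mathcal{H},\ast)$, $$ \sum_{\substack{ r, s_i\geq 1 \\ r+s_1+\cdots +s_{k-1}=n}} z_{r}\ast z_{s_1,\dots, s_{k-1}} = k \sum_{\substack{t_i\geq 1 \\ t_1+\cdots+t_{k}=n}} z_{t_1,\dots, t_{k}} + (n-k+1) \sum_{\substack{u_i\geq 1 \\ u_1+\cdots+u_{k-1}=n }} z_{u_1,\dots, u_{k-1}}. $$
   Context: Let $\mathcal{H}$ be the free $\mathbb{Z}$-module on the free monoid generated by letters $z_s$ ($s\geq 1$ an integer); write $z_{s_1,\dots,s_k}:=z_{s_1}z_{s_2}\cdots z_{s_k}$ for a word and $1$ for the empty word. The quasi-shuffle (stuffle) product $\ast$ is the $\mathbb{Z}$-bilinear product on $\mathcal{H}$ defined on words recursively by $1\ast u=u\ast 1=u$ and $(z_{r}u)\ast(z_{s}v)=z_{r}\,(u\ast (z_{s}v))+z_{s}\,((z_{r}u)\ast v)+z_{r+s}\,(u\ast v)$ for words $u,v$ and integers $r,s\geq 1$ (juxtaposition denotes concatenation, extended linearly). -}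

module Defs where

open import Data.Bool.Base using (if_then_else_)
open import Data.Integer.Base as ℤ using (ℤ; 0ℤ; 1ℤ)
open import Data.List.Base using (List; []; _∷_; _++_; map; concatMap; filter; upTo; cartesianProduct; cartesianProductWith)
open import Data.List.Properties using (≡-dec)
open import Data.Nat.Base as ℕ using (ℕ; zero; suc; NonZero; >-nonZero; >-nonZero⁻¹)
import Data.Nat.Properties as ℕ
open import Data.Product.Base using (_×_; _,_)
open import Data.Vec.Base as Vec using (Vec; []; _∷_; toList)
open import Relation.Binary.Definitions using (DecidableEquality)
open import Relation.Binary.PropositionalEquality using (_≡_; refl; cong)
open import Relation.Nullary.Decidable using (does; map′)

record ℕ⁺ : Set where
  constructor pos
  field
    value : ℕ
    .{{nonZero}} : NonZero value

open ℕ⁺ public using (value)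

value-injective : ∀ {r s} → value r ≡ value s → r ≡ s
value-injective refl = refl

infixl 6 _+⁺_
_+⁺_ : ℕ⁺ → ℕ⁺ → ℕ⁺
pos m +⁺ pos n = pos (m ℕ.+ n) {{>-nonZero (ℕ.<-≤-trans (>-nonZero⁻¹ m) (ℕ.m≤m+n m n))}}

infix 4 _≟⁺_ _≟ʷ_
_≟⁺_ : DecidableEquality ℕ⁺
r ≟⁺ s = map′ value-injective (cong value) (value r ℕ.≟ value s)

-- The letter z_s is represented by its index s.
Word : Set
Word = List ℕ⁺

_≟ʷ_ : DecidableEquality Word
_≟ʷ_ = ≡-dec _≟⁺_

-- Elements of the free ℤ-module on words are finite formal sums of terms
-- c·w, possibly with repeated words; they are identified by _≈_ below,
-- that is, when every word has the same total coefficient in both.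
𝓗 : Set
𝓗 = List (ℤ × Word)

coeff : 𝓗 → Word → ℤ
coeff []            w = 0ℤ
coeff ((c , u) ∷ x) w = (if does (u ≟ʷ w) then c else 0ℤ) ℤ.+ coeff x w

infix 4 _≈_
_≈_ : 𝓗 → 𝓗 → Set
x ≈ y = ∀ w → coeff x w ≡ coeff y w

infixl 6 _⊕_
_⊕_ : 𝓗 → 𝓗 → 𝓗
_⊕_ = _++_

infixr 7 _•_
_•_ : ℤ → 𝓗 → 𝓗
a • x = map (λ (c , w) → a ℤ.* c , w) x

word : Word → 𝓗
word w = (1ℤ , w) ∷ []

linear : (Word → 𝓗) → 𝓗 → 𝓗
linear f = concatMap (λ (c , w) → c • f w)

-- Left concatenation with the letter z_r, extended linearly.
infixr 7 _◃_
_◃_ : ℕ⁺ → 𝓗 → 𝓗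
r ◃ x = linear (λ w → word (r ∷ w)) x

infixl 7 _∗ʷ_ _∗_
_∗ʷ_ : Word → Word → 𝓗
[]      ∗ʷ v       = word v
(r ∷ u) ∗ʷ []      = word (r ∷ u)
(r ∷ u) ∗ʷ (s ∷ v) =
  r ◃ (u ∗ʷ (s ∷ v)) ⊕ s ◃ ((r ∷ u) ∗ʷ v) ⊕ (r +⁺ s) ◃ (u ∗ʷ v)

_∗_ : 𝓗 → 𝓗 → 𝓗
x ∗ y = linear (λ u → linear (λ v → u ∗ʷ v) y) x

z : ∀ {m} → Vec ℕ⁺ m → 𝓗
z s = word (toList s)

∑ : {A : Set} → List A → (A → 𝓗) → 𝓗
∑ xs f = concatMap f xs

oneTo : ℕ → List ℕ⁺
oneTo n = map (λ i → pos (suc i)) (upTo n)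

tuples : {A : Set} → List A → (m : ℕ) → List (Vec A m)
tuples xs zero    = [] ∷ []
tuples xs (suc m) = cartesianProductWith _∷_ xs (tuples xs m)

total : ∀ {m} → Vec ℕ⁺ m → ℕ
total t = Vec.sum (Vec.map value t)

-- All (t₁,…,tₘ) with tᵢ ≥ 1 and t₁+⋯+tₘ = n, each listed once.  Restricting
-- to tᵢ ≤ n loses nothing, as each part is at most the total; likewise below.
compositions : (m n : ℕ) → List (Vec ℕ⁺ m)
compositions m n = filter (λ t → total t ℕ.≟ n) (tuples (oneTo n) m)

-- All (r , (s₁,…,sₘ)) with r, sᵢ ≥ 1 and r+s₁+⋯+sₘ = n, each listed once.
pointedCompositions : (m n : ℕ) → List (ℕ⁺ × Vec ℕ⁺ m)
pointedCompositions m n =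
  filter (λ (r , s) → value r ℕ.+ total s ℕ.≟ n)
         (cartesianProduct (oneTo n) (tuples (oneTo n) m))

{-# OPTIONS --safe #-}

-- The stuffle product is homogeneous for the weight, so for a word w of weight n
-- the coefficient of w on the left-hand side is the sum F m w (m = k - 1) of the
-- coefficients of w in all z_r ∗ z_s with r and the m parts of s ranging freely over
-- {1,…,n}.  Comparing first letters in the recursion for ∗ gives
--   F (m + 1) (a w) = [ |w| = m + 1 ] + F m w + (a - 1) [ |w| = m ],
-- where a - 1 counts the ways to write a = r + s₁.  Hence, by induction on w,
--   F m w = (m + 1) [ |w| = m + 1 ] + (weight w - m) [ |w| = m ].

module Submission where

open import Defs
open import Data.Bool.Base using (Bool; true; false; if_then_else_; _∧_)
open import Data.Integer.Base using (ℤ; +_; _+_; _-_; _*_; 0ℤ; 1ℤ)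
import Data.Integer.Properties as ℤ
open import Data.Integer.Tactic.RingSolver using (solve-∀)
open import Data.List.Base using (List; []; _∷_; _++_; map; filter; length; applyUpTo; upTo; cartesianProductWith)
open import Data.Nat.Base as ℕ using (ℕ; zero; suc; _≤_; _<_; _∸_; _≡ᵇ_; z≤n; s≤s; s≤s⁻¹)
open import Data.Nat.ListAction using (sum)
import Data.Nat.Properties as ℕ
open import Data.Nat.Tactic.RingSolver using () renaming (solve-∀ to solveℕ-∀)
open import Data.Product.Base using (_,_)
open import Data.Vec.Base using (Vec; []; _∷_; [_]; toList)
open import Function.Base using (_∘_)
open import Relation.Binary.PropositionalEquality using (_≡_; _≢_; refl; sym; trans; cong; cong₂; module ≡-Reasoning)
open import Relation.Nullary.Decidable using (does; dec-false)
open import Relation.Nullary using (yes; no)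
open import Relation.Unary using (Decidable)

open ≡-Reasoning

private
  variable
    A B C : Set

-- Indicators and finite integer sums

𝟙 : Bool → ℤ
𝟙 b = if b then 1ℤ else 0ℤ

𝟙-∧ : ∀ b c → 𝟙 (b ∧ c) ≡ 𝟙 b * 𝟙 c
𝟙-∧ true  c = sym (ℤ.*-identityˡ (𝟙 c))
𝟙-∧ false c = refl

if-𝟙 : ∀ b c → (if b then c else 0ℤ) ≡ 𝟙 b * c
if-𝟙 true  c = sym (ℤ.*-identityˡ c)
if-𝟙 false c = refl

∑ᶻ : List A → (A → ℤ) → ℤ
∑ᶻ []       f = 0ℤ
∑ᶻ (x ∷ xs) f = f x + ∑ᶻ xs f

∑ᶻ-cong : ∀ (xs : List A) {f g : A → ℤ} → (∀ x → f x ≡ g x) → ∑ᶻ xs f ≡ ∑ᶻ xs g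
∑ᶻ-cong []       f≗g = refl
∑ᶻ-cong (x ∷ xs) f≗g = cong₂ _+_ (f≗g x) (∑ᶻ-cong xs f≗g)

∑ᶻ-zero : ∀ (xs : List A) → ∑ᶻ xs (λ _ → 0ℤ) ≡ 0ℤ
∑ᶻ-zero []       = refl
∑ᶻ-zero (x ∷ xs) = trans (ℤ.+-identityˡ _) (∑ᶻ-zero xs)

∑ᶻ-+ : ∀ (xs : List A) (f g : A → ℤ) → ∑ᶻ xs (λ x → f x + g x) ≡ ∑ᶻ xs f + ∑ᶻ xs g
∑ᶻ-+ []       f g = refl
∑ᶻ-+ (x ∷ xs) f g = trans (cong (_+_ (f x + g x)) (∑ᶻ-+ xs f g)) (interchange (f x) (g x) (∑ᶻ xs f) (∑ᶻ xs g))
  where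
  interchange : ∀ a b c d → (a + b) + (c + d) ≡ (a + c) + (b + d)
  interchange = solve-∀

∑ᶻ-*ˡ : ∀ (xs : List A) c (f : A → ℤ) → ∑ᶻ xs (λ x → c * f x) ≡ c * ∑ᶻ xs f
∑ᶻ-*ˡ []       c f = sym (ℤ.*-zeroʳ c)
∑ᶻ-*ˡ (x ∷ xs) c f = trans (cong (_+_ (c * f x)) (∑ᶻ-*ˡ xs c f)) (sym (ℤ.*-distribˡ-+ c (f x) (∑ᶻ xs f)))

∑ᶻ-*ʳ : ∀ (xs : List A) c (f : A → ℤ) → ∑ᶻ xs (λ x → f x * c) ≡ ∑ᶻ xs f * c
∑ᶻ-*ʳ xs c f = begin
  ∑ᶻ xs (λ x → f x * c) ≡⟨ ∑ᶻ-cong xs (λ x → ℤ.*-comm (f x) c) ⟩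
  ∑ᶻ xs (λ x → c * f x) ≡⟨ ∑ᶻ-*ˡ xs c f ⟩
  c * ∑ᶻ xs f           ≡⟨ ℤ.*-comm c (∑ᶻ xs f) ⟩
  ∑ᶻ xs f * c           ∎

∑ᶻ-++ : ∀ (xs ys : List A) f → ∑ᶻ (xs ++ ys) f ≡ ∑ᶻ xs f + ∑ᶻ ys f
∑ᶻ-++ []       ys f = sym (ℤ.+-identityˡ _)
∑ᶻ-++ (x ∷ xs) ys f = trans (cong (_+_ (f x)) (∑ᶻ-++ xs ys f)) (sym (ℤ.+-assoc (f x) (∑ᶻ xs f) (∑ᶻ ys f)))

∑ᶻ-map : ∀ (g : A → B) xs f → ∑ᶻ (map g xs) f ≡ ∑ᶻ xs (f ∘ g)
∑ᶻ-map g []       f = refl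
∑ᶻ-map g (x ∷ xs) f = cong (_+_ (f (g x))) (∑ᶻ-map g xs f)

∑ᶻ-filter : ∀ {P : A → Set} (P? : Decidable P) xs f →
  ∑ᶻ (filter P? xs) f ≡ ∑ᶻ xs (λ x → 𝟙 (does (P? x)) * f x)
∑ᶻ-filter P? []       f = refl
∑ᶻ-filter P? (x ∷ xs) f with does (P? x)
... | true  = cong₂ _+_ (sym (ℤ.*-identityˡ (f x))) (∑ᶻ-filter P? xs f)
... | false = trans (∑ᶻ-filter P? xs f) (sym (ℤ.+-identityˡ _))

∑ᶻ-cartesianProductWith : ∀ (g : A → B → C) xs ys f →
  ∑ᶻ (cartesianProductWith g xs ys) f ≡ ∑ᶻ xs (λ x → ∑ᶻ ys (λ y → f (g x y)))
∑ᶻ-cartesianProductWith g []       ys f = refl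
∑ᶻ-cartesianProductWith g (x ∷ xs) ys f =
  trans (∑ᶻ-++ (map (g x) ys) _ f)
        (cong₂ _+_ (∑ᶻ-map (g x) ys f) (∑ᶻ-cartesianProductWith g xs ys f))

∑ᶻ-product : ∀ (xs : List A) (ys : List B) f g →
  ∑ᶻ xs (λ x → ∑ᶻ ys (λ y → f x * g y)) ≡ ∑ᶻ xs f * ∑ᶻ ys g
∑ᶻ-product xs ys f g = trans (∑ᶻ-cong xs (λ x → ∑ᶻ-*ˡ ys (f x) g)) (∑ᶻ-*ʳ xs (∑ᶻ ys g) f)

-- `upTo (suc n)` unfolds to `0 ∷ applyUpTo suc n`, so splitting off index 0 needs a re-indexing.
-- `h` is arbitrary because the induction passes to `h ∘ suc`.
∑ᶻ-applyUpTo : ∀ (h : ℕ → A) n f → ∑ᶻ (applyUpTo h n) f ≡ ∑ᶻ (upTo n) (f ∘ h)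
∑ᶻ-applyUpTo h zero    f = refl
∑ᶻ-applyUpTo h (suc n) f = cong (_+_ (f (h 0)))
  (trans (∑ᶻ-applyUpTo (h ∘ suc) n f) (sym (∑ᶻ-applyUpTo suc n (f ∘ h))))

∑ᶻ-upTo-suc : ∀ n f → ∑ᶻ (upTo (suc n)) f ≡ f 0 + ∑ᶻ (upTo n) (f ∘ suc)
∑ᶻ-upTo-suc n f = cong (_+_ (f 0)) (∑ᶻ-applyUpTo suc n f)

upTo-count : ∀ {n j} → j < n → ∑ᶻ (upTo n) (λ i → 𝟙 (i ≡ᵇ j)) ≡ 1ℤ
upTo-count {suc n} {zero}  _   =
  trans (∑ᶻ-upTo-suc n (λ i → 𝟙 (i ≡ᵇ 0))) (cong (_+_ 1ℤ) (∑ᶻ-zero (upTo n)))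
upTo-count {suc n} {suc j} j<n =
  trans (∑ᶻ-upTo-suc n (λ i → 𝟙 (i ≡ᵇ suc j))) (trans (ℤ.+-identityˡ _) (upTo-count (s≤s⁻¹ j<n)))

-- Each `i < a` admits exactly one `j`, namely `a - 1 - i`, and other `i` admit none. The two ranges
-- have separate bounds because the induction lowers `m` and `a` but keeps `n`.
upTo-count-sum : ∀ {m n a} → a ≤ m → a ≤ n →
  ∑ᶻ (upTo m) (λ i → ∑ᶻ (upTo n) (λ j → 𝟙 (suc i ℕ.+ j ≡ᵇ a))) ≡ + a
upTo-count-sum {m} {n} {zero} _ _ =
  trans (∑ᶻ-cong (upTo m) (λ _ → ∑ᶻ-zero (upTo n))) (∑ᶻ-zero (upTo m))
upTo-count-sum {suc m} {n} {suc a} a<m a<n =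
  trans (∑ᶻ-upTo-suc m (λ i → ∑ᶻ (upTo n) (λ j → 𝟙 (suc i ℕ.+ j ≡ᵇ suc a))))
        (cong₂ _+_ (upTo-count a<n) (upTo-count-sum (s≤s⁻¹ a<m) (ℕ.<⇒≤ a<n)))

oneTo-count : ∀ {n} a → value a ≤ n → ∑ᶻ (oneTo n) (λ r → 𝟙 (does (r ≟⁺ a))) ≡ 1ℤ
oneTo-count {n} (pos (suc j)) a≤n = trans (∑ᶻ-map _ (upTo n) _) (upTo-count a≤n)

oneTo-count-sum : ∀ {n} a → value a ≤ n →
  ∑ᶻ (oneTo n) (λ r → ∑ᶻ (oneTo n) (λ s → 𝟙 (does (r +⁺ s ≟⁺ a)))) ≡ + value a - 1ℤ
oneTo-count-sum {n} (pos (suc j)) a≤n = begin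
  ∑ᶻ (oneTo n) (λ r → ∑ᶻ (oneTo n) (λ s → 𝟙 (value r ℕ.+ value s ≡ᵇ suc j)))
    ≡⟨ ∑ᶻ-map _ (upTo n) _ ⟩
  ∑ᶻ (upTo n) (λ i → ∑ᶻ (oneTo n) (λ s → 𝟙 (i ℕ.+ value s ≡ᵇ j)))
    -- With `s = suc l`, the successor moves from `l` to `i` to match the form of `upTo-count-sum`.
    ≡⟨ ∑ᶻ-cong (upTo n) (λ i → trans (∑ᶻ-map _ (upTo n) _)
         (∑ᶻ-cong (upTo n) (λ l → cong (λ x → 𝟙 (x ≡ᵇ j)) (ℕ.+-suc i l)))) ⟩
  ∑ᶻ (upTo n) (λ i → ∑ᶻ (upTo n) (λ l → 𝟙 (suc i ℕ.+ l ≡ᵇ j)))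
    ≡⟨ upTo-count-sum (ℕ.<⇒≤ a≤n) (ℕ.<⇒≤ a≤n) ⟩
  + j ∎

-- Coefficients

coeff-word : ∀ u w → coeff (word u) w ≡ 𝟙 (does (u ≟ʷ w))
coeff-word u w = ℤ.+-identityʳ _

coeff-⊕ : ∀ x y w → coeff (x ⊕ y) w ≡ coeff x w + coeff y w
coeff-⊕ []            y w = sym (ℤ.+-identityˡ _)
coeff-⊕ ((c , u) ∷ x) y w =
  trans (cong (_+_ k) (coeff-⊕ x y w)) (sym (ℤ.+-assoc k (coeff x w) (coeff y w)))
  where k = if does (u ≟ʷ w) then c else 0ℤ

coeff-• : ∀ a x w → coeff (a • x) w ≡ a * coeff x w
coeff-• a []            w = sym (ℤ.*-zeroʳ a)
coeff-• a ((c , u) ∷ x) w with does (u ≟ʷ w)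
... | true  = trans (cong (_+_ (a * c)) (coeff-• a x w)) (sym (ℤ.*-distribˡ-+ a c (coeff x w)))
... | false = trans (ℤ.+-identityˡ _) (trans (coeff-• a x w) (cong (a *_) (sym (ℤ.+-identityˡ _))))

coeff-∑ : ∀ (xs : List A) f w → coeff (∑ xs f) w ≡ ∑ᶻ xs (λ x → coeff (f x) w)
coeff-∑ []       f w = refl
coeff-∑ (x ∷ xs) f w = trans (coeff-⊕ (f x) (∑ xs f) w) (cong (_+_ (coeff (f x) w)) (coeff-∑ xs f w))

coeff-linear-word : ∀ f u w → coeff (linear f (word u)) w ≡ coeff (f u) w
coeff-linear-word f u w = begin
  coeff (1ℤ • f u ⊕ []) w     ≡⟨ coeff-⊕ (1ℤ • f u) [] w ⟩
  coeff (1ℤ • f u) w + 0ℤ     ≡⟨ ℤ.+-identityʳ _ ⟩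
  coeff (1ℤ • f u) w          ≡⟨ coeff-• 1ℤ (f u) w ⟩
  1ℤ * coeff (f u) w          ≡⟨ ℤ.*-identityˡ _ ⟩
  coeff (f u) w               ∎

coeff-word-∗ : ∀ u v w → coeff (word u ∗ word v) w ≡ coeff (u ∗ʷ v) w
coeff-word-∗ u v w = trans (coeff-linear-word (λ u → linear (u ∗ʷ_) (word v)) u w) (coeff-linear-word (u ∗ʷ_) v w)

coeff-◃-[] : ∀ r x → coeff (r ◃ x) [] ≡ 0ℤ
coeff-◃-[] r []            = refl
coeff-◃-[] r ((c , u) ∷ x) = trans (ℤ.+-identityˡ _) (coeff-◃-[] r x)

-- This turns the recursion for the product into a recursion on the first letter of the word whose
-- coefficient is taken.
coeff-◃-∷ : ∀ r x a w → coeff (r ◃ x) (a ∷ w) ≡ 𝟙 (does (r ≟⁺ a)) * coeff x w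
coeff-◃-∷ r []            a w = sym (ℤ.*-zeroʳ (𝟙 (does (r ≟⁺ a))))
coeff-◃-∷ r ((c , u) ∷ x) a w = begin
  -- Comparison of nonempty words unfolds to heads and tails; the factor `1ℤ` is the coefficient
  -- inside `word`.
  (if does (r ≟⁺ a) ∧ does (u ≟ʷ w) then c * 1ℤ else 0ℤ) + coeff (r ◃ x) (a ∷ w)
    ≡⟨ cong₂ _+_ (if-𝟙 (does (r ≟⁺ a) ∧ does (u ≟ʷ w)) (c * 1ℤ)) (coeff-◃-∷ r x a w) ⟩
  𝟙 (does (r ≟⁺ a) ∧ does (u ≟ʷ w)) * (c * 1ℤ) + p * coeff x w
    ≡⟨ cong (λ i → i * (c * 1ℤ) + p * coeff x w) (𝟙-∧ (does (r ≟⁺ a)) (does (u ≟ʷ w))) ⟩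
  (p * q) * (c * 1ℤ) + p * coeff x w
    ≡⟨ factor p q c (coeff x w) ⟩
  p * (q * c + coeff x w)
    ≡⟨ cong (λ i → p * (i + coeff x w)) (if-𝟙 (does (u ≟ʷ w)) c) ⟨
  p * ((if does (u ≟ʷ w) then c else 0ℤ) + coeff x w) ∎
  where
  p q : ℤ
  p = 𝟙 (does (r ≟⁺ a))
  q = 𝟙 (does (u ≟ʷ w))
  factor : ∀ p q c d → (p * q) * (c * 1ℤ) + p * d ≡ p * (q * c + d)
  factor = solve-∀

-- Homogeneity

weight : Word → ℕ
weight w = sum (map value w)

weight-toList : ∀ {m} (t : Vec ℕ⁺ m) → weight (toList t) ≡ total t
weight-toList []      = refl
weight-toList (a ∷ t) = cong (value a ℕ.+_) (weight-toList t)

-- Phrased through coefficients rather than listed terms, so the notion respects `_≈_`.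
Homogeneous : ℕ → 𝓗 → Set
Homogeneous d x = ∀ w → weight w ≢ d → coeff x w ≡ 0ℤ

word-homogeneous : ∀ u → Homogeneous (weight u) (word u)
word-homogeneous u w w≢u =
  trans (coeff-word u w) (cong 𝟙 (dec-false (u ≟ʷ w) (λ { refl → w≢u refl })))

⊕-homogeneous : ∀ {d} x y → Homogeneous d x → Homogeneous d y → Homogeneous d (x ⊕ y)
⊕-homogeneous x y hx hy w w≢d =
  trans (coeff-⊕ x y w) (cong₂ _+_ (hx w w≢d) (hy w w≢d))

-- The new weight `e` comes with an equation so that each use can supply its own rearrangement of
-- the sum.
◃-homogeneous : ∀ {d} e r x → value r ℕ.+ d ≡ e → Homogeneous d x → Homogeneous e (r ◃ x)
◃-homogeneous e r x eq hx []      _   = coeff-◃-[] r x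
◃-homogeneous e r x eq hx (a ∷ w) w≢e with r ≟⁺ a
... | no r≢a   = trans (coeff-◃-∷ r x a w) (cong (λ b → 𝟙 b * coeff x w) (dec-false (r ≟⁺ a) r≢a))
... | yes refl = trans (coeff-◃-∷ r x a w) (trans
  (cong (𝟙 (does (r ≟⁺ a)) *_) (hx w (λ w≡d → w≢e (trans (cong (value r ℕ.+_) w≡d) eq))))
  (ℤ.*-zeroʳ (𝟙 (does (r ≟⁺ a)))))

-- In all three terms of the recursion the prefixed letter restores exactly the weight missing from
-- the smaller product; merging `r` and `s` preserves their sum.
∗ʷ-homogeneous : ∀ u v → Homogeneous (weight u ℕ.+ weight v) (u ∗ʷ v)
∗ʷ-homogeneous []      v       = word-homogeneous v
∗ʷ-homogeneous (r ∷ u) []      rewrite ℕ.+-identityʳ (weight (r ∷ u)) = word-homogeneous (r ∷ u)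
∗ʷ-homogeneous (r ∷ u) (s ∷ v) =
  ⊕-homogeneous (r ◃ x₁ ⊕ s ◃ x₂) ((r +⁺ s) ◃ x₃)
    (⊕-homogeneous (r ◃ x₁) (s ◃ x₂)
      (◃-homogeneous _ r x₁ (sym (ℕ.+-assoc (value r) (weight u) _)) (∗ʷ-homogeneous u (s ∷ v)))
      (◃-homogeneous _ s x₂ (exchange (value s) (weight (r ∷ u)) (weight v)) (∗ʷ-homogeneous (r ∷ u) v)))
    (◃-homogeneous _ (r +⁺ s) x₃ (interchange (value r) (value s) (weight u) (weight v)) (∗ʷ-homogeneous u v))
  where
  x₁ x₂ x₃ : 𝓗
  x₁ = u ∗ʷ (s ∷ v)
  x₂ = (r ∷ u) ∗ʷ v
  x₃ = u ∗ʷ v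
  exchange : ∀ a b c → a ℕ.+ (b ℕ.+ c) ≡ b ℕ.+ (a ℕ.+ c)
  exchange = solveℕ-∀
  interchange : ∀ a b c d → (a ℕ.+ b) ℕ.+ (c ℕ.+ d) ≡ (a ℕ.+ c) ℕ.+ (b ℕ.+ d)
  interchange = solveℕ-∀

-- Either `w` has weight `d` or its coefficient is zero. A condition on the summation index thus
-- becomes a condition on `w` alone, which can leave the sum.
homogeneous-𝟙 : ∀ {d} n x w → Homogeneous d x →
  𝟙 (d ≡ᵇ n) * coeff x w ≡ 𝟙 (weight w ≡ᵇ n) * coeff x w
homogeneous-𝟙 {d} n x w hx with weight w ℕ.≟ d
... | yes refl = refl
... | no w≢d rewrite hx w w≢d =
  trans (ℤ.*-zeroʳ (𝟙 (d ≡ᵇ n))) (sym (ℤ.*-zeroʳ (𝟙 (weight w ≡ᵇ n))))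

-- Sums over all tuples with parts at most n

-- The weight bound keeps every letter of `w` within `oneTo n`, so a word of length `m` is listed
-- exactly once.
tuples-count : ∀ {n} m w → weight w ≤ n →
  ∑ᶻ (tuples (oneTo n) m) (λ t → coeff (z t) w) ≡ 𝟙 (length w ≡ᵇ m)
tuples-count zero    []      _ = refl
tuples-count zero    (a ∷ w) _ = refl
tuples-count {n} (suc m) [] _ = begin
  ∑ᶻ (tuples (oneTo n) (suc m)) (λ t → coeff (z t) [])
    ≡⟨ ∑ᶻ-cartesianProductWith _∷_ (oneTo n) (tuples (oneTo n) m) _ ⟩
  ∑ᶻ (oneTo n) (λ _ → ∑ᶻ (tuples (oneTo n) m) (λ _ → 0ℤ))
    ≡⟨ ∑ᶻ-cong (oneTo n) (λ _ → ∑ᶻ-zero (tuples (oneTo n) m)) ⟩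
  ∑ᶻ (oneTo n) (λ _ → 0ℤ)
    ≡⟨ ∑ᶻ-zero (oneTo n) ⟩
  0ℤ ∎
tuples-count {n} (suc m) (a ∷ w) aw≤n = begin
  ∑ᶻ (tuples (oneTo n) (suc m)) (λ t → coeff (z t) (a ∷ w))
    ≡⟨ ∑ᶻ-cartesianProductWith _∷_ (oneTo n) (tuples (oneTo n) m) _ ⟩
  ∑ᶻ (oneTo n) (λ r → ∑ᶻ (tuples (oneTo n) m) (λ t → coeff (z (r ∷ t)) (a ∷ w)))
    -- `z (r ∷ t)` and `r ◃ z t` agree by computation.
    ≡⟨ ∑ᶻ-cong (oneTo n) (λ r → ∑ᶻ-cong (tuples (oneTo n) m) (λ t → coeff-◃-∷ r (z t) a w)) ⟩
  ∑ᶻ (oneTo n) (λ r → ∑ᶻ (tuples (oneTo n) m) (λ t → 𝟙 (does (r ≟⁺ a)) * coeff (z t) w))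
    ≡⟨ ∑ᶻ-product (oneTo n) (tuples (oneTo n) m) _ _ ⟩
  ∑ᶻ (oneTo n) (λ r → 𝟙 (does (r ≟⁺ a))) * ∑ᶻ (tuples (oneTo n) m) (λ t → coeff (z t) w)
    ≡⟨ cong₂ _*_ (oneTo-count a (ℕ.m+n≤o⇒m≤o (value a) aw≤n))
                 (tuples-count m w (ℕ.m+n≤o⇒n≤o (value a) aw≤n)) ⟩
  1ℤ * 𝟙 (length w ≡ᵇ m)
    ≡⟨ ℤ.*-identityˡ _ ⟩
  𝟙 (length w ≡ᵇ m) ∎

-- Recursion and closed form for the unrestricted stuffle sum

-- This is `F m w`. With no condition on the total, the index set is a full product, so sums over it
-- can factor.
stuffleSum : ℕ → ℕ → Word → ℤ
stuffleSum n m w = ∑ᶻ (oneTo n) (λ r → ∑ᶻ (tuples (oneTo n) m) (λ s → coeff ((r ∷ []) ∗ʷ toList s) w))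

-- The first letter `a` is `r`, `s` or `r +⁺ s`. As the left factor is a single letter, the first
-- and third cases leave a plain word.
coeff-∷-∗ʷ-∷ : ∀ r s v a w → coeff ((r ∷ []) ∗ʷ (s ∷ v)) (a ∷ w) ≡
  𝟙 (does (r ≟⁺ a)) * coeff (word (s ∷ v)) w
    + 𝟙 (does (s ≟⁺ a)) * coeff ((r ∷ []) ∗ʷ v) w
    + 𝟙 (does (r +⁺ s ≟⁺ a)) * coeff (word v) w
coeff-∷-∗ʷ-∷ r s v a w =
  trans (coeff-⊕ (X ⊕ Y) Z (a ∷ w))
    (cong₂ _+_ (trans (coeff-⊕ X Y (a ∷ w))
                      (cong₂ _+_ (coeff-◃-∷ r (word (s ∷ v)) a w) (coeff-◃-∷ s ((r ∷ []) ∗ʷ v) a w)))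
               (coeff-◃-∷ (r +⁺ s) (word v) a w))
  where
  X Y Z : 𝓗
  X = r ◃ word (s ∷ v)
  Y = s ◃ ((r ∷ []) ∗ʷ v)
  Z = (r +⁺ s) ◃ word v

-- The letter `r` gives every product positive weight, so homogeneity excludes the empty word.
stuffleSum-[] : ∀ n m → stuffleSum n m [] ≡ 0ℤ
stuffleSum-[] n m =
  trans (∑ᶻ-cong (oneTo n) (λ r → trans (∑ᶻ-cong (tuples (oneTo n) m) (λ s → vanish r (toList s)))
                                       (∑ᶻ-zero (tuples (oneTo n) m))))
        (∑ᶻ-zero (oneTo n))
  where
  vanish : ∀ r v → coeff ((r ∷ []) ∗ʷ v) [] ≡ 0ℤ
  vanish r v = ∗ʷ-homogeneous (r ∷ []) v [] (ℕ.<⇒≢ (positive r))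
    where
    positive : ∀ r → 0 < value r ℕ.+ 0 ℕ.+ weight v
    positive (pos (suc _)) = s≤s z≤n

stuffleSum-∷ : ∀ n m a w → value a ℕ.+ weight w ≤ n →
  stuffleSum n (suc m) (a ∷ w) ≡
    𝟙 (length w ≡ᵇ suc m) + stuffleSum n m w + (+ value a - 1ℤ) * 𝟙 (length w ≡ᵇ m)
stuffleSum-∷ n m a w aw≤n = begin
  stuffleSum n (suc m) (a ∷ w)
    ≡⟨ ∑ᶻ-cong R (λ r → ∑ᶻ-cartesianProductWith _∷_ R T _) ⟩
  ∑ᶻ R (λ r → ∑ᶻ R (λ s → ∑ᶻ T (λ v → coeff ((r ∷ []) ∗ʷ (s ∷ toList v)) (a ∷ w))))
    ≡⟨ ∑ᶻ-cong R (λ r → ∑ᶻ-cong R (λ s → ∑ᶻ-cong T (λ v → coeff-∷-∗ʷ-∷ r s (toList v) a w))) ⟩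
  ∑ᶻ R (λ r → ∑ᶻ R (λ s → ∑ᶻ T (λ v → f r s v + g r s v + h r s v)))
    ≡⟨ ∑³-+ (λ r s v → f r s v + g r s v) h ⟩
  ∑³ (λ r s v → f r s v + g r s v) + ∑³ h
    ≡⟨ cong (_+ ∑³ h) (∑³-+ f g) ⟩
  ∑³ f + ∑³ g + ∑³ h
    ≡⟨ cong₂ _+_ (cong₂ _+_ first second) third ⟩
  𝟙 (length w ≡ᵇ suc m) + stuffleSum n m w + (+ value a - 1ℤ) * 𝟙 (length w ≡ᵇ m) ∎
  where
  R : List ℕ⁺
  R = oneTo n
  T : List (Vec ℕ⁺ m)
  T = tuples R m
  a≤n : value a ≤ n
  a≤n = ℕ.m+n≤o⇒m≤o (value a) aw≤n
  w≤n : weight w ≤ n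
  w≤n = ℕ.m+n≤o⇒n≤o (value a) aw≤n

  f g h : ℕ⁺ → ℕ⁺ → Vec ℕ⁺ m → ℤ
  f r s v = 𝟙 (does (r ≟⁺ a)) * coeff (z (s ∷ v)) w
  g r s v = 𝟙 (does (s ≟⁺ a)) * coeff ((r ∷ []) ∗ʷ toList v) w
  h r s v = 𝟙 (does (r +⁺ s ≟⁺ a)) * coeff (z v) w

  ∑³ : (ℕ⁺ → ℕ⁺ → Vec ℕ⁺ m → ℤ) → ℤ
  ∑³ f = ∑ᶻ R (λ r → ∑ᶻ R (λ s → ∑ᶻ T (λ v → f r s v)))

  ∑³-+ : ∀ f g → ∑³ (λ r s v → f r s v + g r s v) ≡ ∑³ f + ∑³ g
  ∑³-+ f g =
    trans (∑ᶻ-cong R (λ r → trans (∑ᶻ-cong R (λ s → ∑ᶻ-+ T (f r s) (g r s))) (∑ᶻ-+ R _ _)))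
          (∑ᶻ-+ R _ _)

  first : ∑³ f ≡ 𝟙 (length w ≡ᵇ suc m)
  first = begin
    ∑³ f
      -- Here `r` must be `a`; regrouping `s` and `v` into one tuple makes the sum a product of two
      -- counts.
      ≡⟨ ∑ᶻ-cong R (λ r → ∑ᶻ-cartesianProductWith _∷_ R T (λ t → 𝟙 (does (r ≟⁺ a)) * coeff (z t) w)) ⟨
    ∑ᶻ R (λ r → ∑ᶻ (tuples R (suc m)) (λ t → 𝟙 (does (r ≟⁺ a)) * coeff (z t) w))
      ≡⟨ ∑ᶻ-product R (tuples R (suc m)) _ _ ⟩
    ∑ᶻ R (λ r → 𝟙 (does (r ≟⁺ a))) * ∑ᶻ (tuples R (suc m)) (λ t → coeff (z t) w)
      ≡⟨ cong₂ _*_ (oneTo-count a a≤n) (tuples-count (suc m) w w≤n) ⟩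
    1ℤ * 𝟙 (length w ≡ᵇ suc m)
      ≡⟨ ℤ.*-identityˡ _ ⟩
    𝟙 (length w ≡ᵇ suc m) ∎

  second : ∑³ g ≡ stuffleSum n m w
  -- Here `s` must be `a`, and the free `r` and `v` form the sum with one part fewer.
  second = ∑ᶻ-cong R (λ r →
    trans (∑ᶻ-product R T _ _)
          (trans (cong (_* ∑ᶻ T (λ v → coeff ((r ∷ []) ∗ʷ toList v) w)) (oneTo-count a a≤n))
                 (ℤ.*-identityˡ _)))

  third : ∑³ h ≡ (+ value a - 1ℤ) * 𝟙 (length w ≡ᵇ m)
  third = begin
    ∑³ h
      ≡⟨ ∑ᶻ-cong R (λ r → ∑ᶻ-product R T _ _) ⟩
    ∑ᶻ R (λ r → ∑ᶻ R (λ s → 𝟙 (does (r +⁺ s ≟⁺ a))) * ∑ᶻ T (λ v → coeff (z v) w))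
      ≡⟨ ∑ᶻ-*ʳ R _ _ ⟩
    ∑ᶻ R (λ r → ∑ᶻ R (λ s → 𝟙 (does (r +⁺ s ≟⁺ a)))) * ∑ᶻ T (λ v → coeff (z v) w)
      -- The splittings of `a` into `r` and `s` are independent of the choice of `v`.
      ≡⟨ cong₂ _*_ (oneTo-count-sum a a≤n) (tuples-count m w w≤n) ⟩
    (+ value a - 1ℤ) * 𝟙 (length w ≡ᵇ m) ∎

stuffleSum-closed : ∀ n m w → weight w ≤ n →
  stuffleSum n m w ≡ + suc m * 𝟙 (length w ≡ᵇ suc m) + (+ weight w - + m) * 𝟙 (length w ≡ᵇ m)
stuffleSum-closed n zero w w≤n = begin
  stuffleSum n zero w
    -- A letter times the empty word is that letter, so this is the count of one-letter words.
    ≡⟨ ∑ᶻ-cartesianProductWith _∷_ (oneTo n) ([] ∷ []) (λ t → coeff (z t) w) ⟨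
  ∑ᶻ (tuples (oneTo n) 1) (λ t → coeff (z t) w)
    ≡⟨ tuples-count 1 w w≤n ⟩
  𝟙 (length w ≡ᵇ 1)
    ≡⟨ unit w ⟩
  1ℤ * 𝟙 (length w ≡ᵇ 1) + (+ weight w - 0ℤ) * 𝟙 (length w ≡ᵇ 0) ∎
  where
  -- The last term vanishes: an empty `w` has weight 0, and a nonempty one has length indicator 0.
  unit : ∀ w → 𝟙 (length w ≡ᵇ 1) ≡ 1ℤ * 𝟙 (length w ≡ᵇ 1) + (+ weight w - 0ℤ) * 𝟙 (length w ≡ᵇ 0)
  unit []      = refl
  unit (a ∷ w) = sym (trans (cong₂ _+_ (ℤ.*-identityˡ p) (ℤ.*-zeroʳ (+ weight (a ∷ w) - 0ℤ))) (ℤ.+-identityʳ p))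
    where p = 𝟙 (length w ≡ᵇ 0)
stuffleSum-closed n (suc m) [] _ =
  trans (stuffleSum-[] n (suc m)) (sym (cong₂ _+_ (ℤ.*-zeroʳ (+ suc (suc m))) (ℤ.*-zeroʳ (0ℤ - + suc m))))
stuffleSum-closed n (suc m) (a ∷ w) aw≤n = begin
  stuffleSum n (suc m) (a ∷ w)
    ≡⟨ stuffleSum-∷ n m a w aw≤n ⟩
  p + stuffleSum n m w + (+ value a - 1ℤ) * q
    ≡⟨ cong (λ x → p + x + (+ value a - 1ℤ) * q) (stuffleSum-closed n m w (ℕ.m+n≤o⇒n≤o (value a) aw≤n)) ⟩
  p + (+ suc m * p + (+ weight w - + m) * q) + (+ value a - 1ℤ) * q
    ≡⟨ collect (+ m) (+ value a) (+ weight w) p q ⟩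
  + suc (suc m) * p + (+ weight (a ∷ w) - + suc m) * q ∎
  where
  p q : ℤ
  p = 𝟙 (length w ≡ᵇ suc m)
  q = 𝟙 (length w ≡ᵇ m)
  -- `1ℤ + m` and `a + b` are the computed forms of `+ suc m` and of the weight of `a ∷ w`.
  collect : ∀ m a b p q → p + ((1ℤ + m) * p + (b - m) * q) + (a - 1ℤ) * q
                        ≡ (1ℤ + (1ℤ + m)) * p + ((a + b) - (1ℤ + m)) * q
  collect = solve-∀

-- Restriction to total n

coeff-compositions : ∀ m n w →
  coeff (∑ (compositions m n) z) w ≡ 𝟙 (weight w ≡ᵇ n) * ∑ᶻ (tuples (oneTo n) m) (λ t → coeff (z t) w)
coeff-compositions m n w = begin
  coeff (∑ (compositions m n) z) w
    ≡⟨ coeff-∑ (compositions m n) z w ⟩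
  ∑ᶻ (compositions m n) (λ t → coeff (z t) w)
    ≡⟨ ∑ᶻ-filter _ (tuples (oneTo n) m) _ ⟩
  ∑ᶻ (tuples (oneTo n) m) (λ t → 𝟙 (total t ≡ᵇ n) * coeff (z t) w)
    ≡⟨ ∑ᶻ-cong (tuples (oneTo n) m) (λ t →
         trans (cong (λ d → 𝟙 (d ≡ᵇ n) * coeff (z t) w) (sym (weight-toList t)))
               (homogeneous-𝟙 n (z t) w (word-homogeneous (toList t)))) ⟩
  ∑ᶻ (tuples (oneTo n) m) (λ t → 𝟙 (weight w ≡ᵇ n) * coeff (z t) w)
    ≡⟨ ∑ᶻ-*ˡ (tuples (oneTo n) m) (𝟙 (weight w ≡ᵇ n)) (λ t → coeff (z t) w) ⟩
  𝟙 (weight w ≡ᵇ n) * ∑ᶻ (tuples (oneTo n) m) (λ t → coeff (z t) w) ∎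

coeff-pointedCompositions : ∀ m n w →
  coeff (∑ (pointedCompositions m n) (λ (r , s) → z [ r ] ∗ z s)) w ≡ 𝟙 (weight w ≡ᵇ n) * stuffleSum n m w
coeff-pointedCompositions m n w = begin
  coeff (∑ (pointedCompositions m n) (λ (r , s) → z [ r ] ∗ z s)) w
    ≡⟨ coeff-∑ (pointedCompositions m n) _ w ⟩
  ∑ᶻ (pointedCompositions m n) (λ (r , s) → coeff (z [ r ] ∗ z s) w)
    ≡⟨ ∑ᶻ-filter _ (cartesianProductWith _,_ R T) _ ⟩
  ∑ᶻ (cartesianProductWith _,_ R T) (λ (r , s) → 𝟙 (value r ℕ.+ total s ≡ᵇ n) * coeff (z [ r ] ∗ z s) w)
    ≡⟨ ∑ᶻ-cartesianProductWith _,_ R T _ ⟩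
  ∑ᶻ R (λ r → ∑ᶻ T (λ s → 𝟙 (value r ℕ.+ total s ≡ᵇ n) * coeff (z [ r ] ∗ z s) w))
    ≡⟨ ∑ᶻ-cong R (λ r → ∑ᶻ-cong T (λ s → pull r s)) ⟩
  ∑ᶻ R (λ r → ∑ᶻ T (λ s → 𝟙 (weight w ≡ᵇ n) * coeff ((r ∷ []) ∗ʷ toList s) w))
    ≡⟨ ∑ᶻ-cong R (λ r → ∑ᶻ-*ˡ T (𝟙 (weight w ≡ᵇ n)) (λ s → coeff ((r ∷ []) ∗ʷ toList s) w)) ⟩
  ∑ᶻ R (λ r → 𝟙 (weight w ≡ᵇ n) * ∑ᶻ T (λ s → coeff ((r ∷ []) ∗ʷ toList s) w))
    ≡⟨ ∑ᶻ-*ˡ R (𝟙 (weight w ≡ᵇ n)) (λ r → ∑ᶻ T (λ s → coeff ((r ∷ []) ∗ʷ toList s) w)) ⟩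
  𝟙 (weight w ≡ᵇ n) * stuffleSum n m w ∎
  where
  R : List ℕ⁺
  R = oneTo n
  T : List (Vec ℕ⁺ m)
  T = tuples R m
  pull : ∀ r s → 𝟙 (value r ℕ.+ total s ≡ᵇ n) * coeff (z [ r ] ∗ z s) w
               ≡ 𝟙 (weight w ≡ᵇ n) * coeff ((r ∷ []) ∗ʷ toList s) w
  pull r s = begin
    𝟙 (value r ℕ.+ total s ≡ᵇ n) * coeff (z [ r ] ∗ z s) w
      ≡⟨ cong₂ (λ d c → 𝟙 (d ≡ᵇ n) * c)
           (cong₂ ℕ._+_ (sym (ℕ.+-identityʳ (value r))) (sym (weight-toList s)))
           (coeff-word-∗ (r ∷ []) (toList s) w) ⟩
    𝟙 (weight (r ∷ []) ℕ.+ weight (toList s) ≡ᵇ n) * coeff ((r ∷ []) ∗ʷ toList s) w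
      ≡⟨ homogeneous-𝟙 n ((r ∷ []) ∗ʷ toList s) w (∗ʷ-homogeneous (r ∷ []) (toList s)) ⟩
    𝟙 (weight w ≡ᵇ n) * coeff ((r ∷ []) ∗ʷ toList s) w ∎

-- Behind the indicator `m ≡ n` may be assumed, since otherwise both sides are zero.
𝟙-*-cong : ∀ m n {x y} → (m ≡ n → x ≡ y) → 𝟙 (m ≡ᵇ n) * x ≡ 𝟙 (m ≡ᵇ n) * y
𝟙-*-cong m n x≡y with m ℕ.≟ n
... | yes m≡n = cong (𝟙 (m ≡ᵇ n) *_) (x≡y m≡n)
... | no  m≢n rewrite dec-false (m ℕ.≟ n) m≢n = refl

theorem2p3 : (k n : ℕ) → 2 ≤ k → k ≤ n →
    ∑ (pointedCompositions (k ∸ 1) n) (λ (r , s) → z [ r ] ∗ z s)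
      ≈ (+ k) • ∑ (compositions k n) (λ t → z t)
        ⊕ (+ n - + k + 1ℤ) • ∑ (compositions (k ∸ 1) n) (λ u → z u)
theorem2p3 (suc m) n _ _ w = begin
  coeff (∑ (pointedCompositions m n) (λ (r , s) → z [ r ] ∗ z s)) w
    ≡⟨ coeff-pointedCompositions m n w ⟩
  e * stuffleSum n m w
    -- Only words of weight `n` matter. For these the bound of the closed form holds and `weight w`
    -- in its coefficient becomes `n`.
    ≡⟨ 𝟙-*-cong (weight w) n compare ⟩
  e * (+ suc m * p + (+ n - + m) * q)
    ≡⟨ distribute e (+ m) (+ n) p q ⟩
  + suc m * (e * p) + (+ n - + suc m + 1ℤ) * (e * q)
    ≡⟨ cong₂ (λ x y → + suc m * x + (+ n - + suc m + 1ℤ) * y)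
         (coeff-compositions (suc m) n w) (coeff-compositions m n w) ⟨
  + suc m * coeff X w + (+ n - + suc m + 1ℤ) * coeff Y w
    ≡⟨ cong₂ _+_ (coeff-• (+ suc m) X w) (coeff-• (+ n - + suc m + 1ℤ) Y w) ⟨
  coeff ((+ suc m) • X) w + coeff ((+ n - + suc m + 1ℤ) • Y) w
    ≡⟨ coeff-⊕ ((+ suc m) • X) _ w ⟨
  coeff ((+ suc m) • X ⊕ (+ n - + suc m + 1ℤ) • Y) w ∎
  where
  X Y : 𝓗
  X = ∑ (compositions (suc m) n) z
  Y = ∑ (compositions m n) z
  e p q : ℤ
  e = 𝟙 (weight w ≡ᵇ n)
  p = ∑ᶻ (tuples (oneTo n) (suc m)) (λ t → coeff (z t) w)
  q = ∑ᶻ (tuples (oneTo n) m) (λ t → coeff (z t) w)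
  compare : weight w ≡ n → stuffleSum n m w ≡ + suc m * p + (+ n - + m) * q
  compare refl = trans (stuffleSum-closed n m w ℕ.≤-refl)
    (sym (cong₂ (λ x y → + suc m * x + (+ n - + m) * y)
      (tuples-count (suc m) w ℕ.≤-refl) (tuples-count m w ℕ.≤-refl)))
  -- With `k = 1 + m`, the coefficient `n - m` is rewritten as `n - k + 1`.
  distribute : ∀ e m n p q → e * ((1ℤ + m) * p + (n - m) * q)
                           ≡ (1ℤ + m) * (e * p) + (n - (1ℤ + m) + 1ℤ) * (e * q)
  distribute = solve-∀
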